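{- Let $n$ be a nonnegative integer. There is an irreducible cubefree binary word of length $n$ if and only if $n \in \{10, 14, 18, 19, 20\} \cup \{m \mid m \geq 22\}$.
   Context: Words are finite strings over the binary alphabet $\{0,1\}$. A factor of a word is a contiguous subword. A cube is a word of the form $XXX$ with $X$ a nonempty word; a word is cubefree if none of its factors is a cube. A letter of a word is interior if it is neither the first nor the last letter of the word. An irreducible cubefree word is a cubefree word of length at least $3$ such that removing any one of its interior letters yields a word containing a cube as a factor. -}

module Defs where

open import Data.Bool using (Bool)
open import Data.List using (List; []; _∷_; _++_; length; take; drop)
open import Data.Nat using (ℕ; suc; _≤_; _<_)
open import Data.Product using (Σ; ∃; _×_)
open import Relation.Binary.PropositionalEquality using (_≡_)
open import Relation.Nullary using (¬_)

Word : Set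
Word = List Bool

IsFactor : Word → Word → Set
IsFactor f w = ∃ λ u → ∃ λ v → w ≡ u ++ (f ++ v)

IsCube : Word → Set
IsCube c = ∃ λ X → ¬ (X ≡ []) × (c ≡ X ++ (X ++ X))

ContainsCube : Word → Set
ContainsCube w = ∃ λ c → IsCube c × IsFactor c w

CubeFree : Word → Set
CubeFree w = ¬ ContainsCube w

removeAt : ℕ → Word → Word
removeAt i w = take i w ++ drop (suc i) w

IrreducibleCubeFree : Word → Set
IrreducibleCubeFree w =
  CubeFree w × (3 ≤ length w) ×
  (∀ i → 1 ≤ i → suc i < length w → ContainsCube (removeAt i w))

{-# OPTIONS --safe #-}
-- Words of length at most 21 are enumerated by a backtracking search. It extends
-- words letter by letter and drops a word as soon as it contains a cube, or the
-- removal of some letter can no longer create a cube whatever follows.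
--
-- Long words are images of the Thue–Morse word under a 17-uniform morphism for
-- which no block occurs in the image of a two-letter word except at the two block
-- positions. A cube of period p in such an image is therefore either short, which
-- a finite check rules out, or has 17 ∣ p and then yields an overlap of period
-- p / 17 in the Thue–Morse word. Removing any letter from a block creates a cube
-- inside the block and its two neighbours. One of 17 prefixes in front of the
-- image, and the prefix 010 of the next block behind it, give every length ≥ 47
-- and keep the letters near the two ends irreducible as well.
module Submission where

open import Defs
open import Data.List using (length)
open import Data.Nat using (ℕ; _≤_)
open import Data.Product using (∃; _×_)
open import Data.Sum using (_⊎_)
open import Function.Bundles using (_⇔_)
open import Relation.Binary.PropositionalEquality using (_≡_)

open import Data.Bool using (Bool; true; false; not; _∧_; _∨_; _xor_; T)
open import Data.Bool.Properties as Bool using (T-∧; T-∨; not-involutive; not-¬; not-injective)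
open import Data.Char using () renaming (toℕ to charCode)
open import Data.Empty using (⊥; ⊥-elim)
open import Data.Fin using (Fin; toℕ; fromℕ<)
open import Data.Fin.Properties using (all?; toℕ-fromℕ<)
open import Data.List using ([]; _∷_; _++_; map; take; drop; applyUpTo)
open import Data.List.Properties using (++-assoc; ++-identityʳ; take++drop≡id; length-++; length-applyUpTo; length-drop)
open import Data.Nat
  using (zero; suc; s≤s⁻¹; _+_; _*_; _∸_; _<_; _/_; _%_; _≡ᵇ_; z≤n; s≤s; z<s; s<s; ⌊_/2⌋; _≤?_; _<?_; _≟_)
open import Data.Nat.DivMod
open import Data.Nat.Divisibility using (n∣m*n)
open import Data.Nat.Induction using (<-rec)
open import Data.Nat.Properties
open import Data.Nat.Tactic.RingSolver using (solve-∀)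
open import Data.Product using (_,_; proj₁; proj₂)
open import Data.String using (String; toList)
open import Data.Sum using (inj₁; inj₂; map₂)
open import Data.Unit using (tt)
open import Data.Vec using (Vec; lookup) renaming ([] to []ᵛ; _∷_ to _∷ᵛ_)
open import Function.Base using (_∘_)
open import Function.Bundles using (Equivalence; mk⇔)
open import Relation.Binary.PropositionalEquality using (refl; sym; trans; cong; cong₂; subst; module ≡-Reasoning)
open import Relation.Nullary using (¬_; Dec; yes; no)
open import Relation.Nullary.Decidable using (⌊_⌋; toWitness; fromWitness; _⊎-dec_; T?)

open Equivalence using () renaming (to to ⇒; from to ⇐)

-- Occurrences of cubes by position

nth : Word → ℕ → Bool
nth []      _       = false
nth (x ∷ _) zero    = x
nth (_ ∷ w) (suc i) = nth w i

Agree : (ℕ → Bool) → ℕ → ℕ → ℕ → Set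
Agree s i j n = ∀ k → k < n → s (i + k) ≡ s (j + k)

-- A cube is a factor of length 3p with period p, so 2p equalities of letters describe it. The
-- length bound keeps the default value of `nth` out of play.
CubeAt : Word → ℕ → ℕ → Set
CubeAt w i p = 1 ≤ p × i + (p + (p + p)) ≤ length w × Agree (nth w) i (i + p) (p + p)

nth-++ˡ : ∀ u v k → k < length u → nth (u ++ v) k ≡ nth u k
nth-++ˡ (x ∷ u) v zero    _         = refl
nth-++ˡ (x ∷ u) v (suc k) (s≤s k<u) = nth-++ˡ u v k k<u

nth-++ʳ : ∀ u v k → nth (u ++ v) (length u + k) ≡ nth v k
nth-++ʳ []      v k = refl
nth-++ʳ (x ∷ u) v k = nth-++ʳ u v k

nth-drop : ∀ i w k → nth (drop i w) k ≡ nth w (i + k)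
nth-drop zero    w       k = refl
nth-drop (suc i) []      k = refl
nth-drop (suc i) (x ∷ w) k = nth-drop i w k

<-length-drop : ∀ i (w : Word) k → k < length (drop i w) → i + k < length w
<-length-drop zero    w       k lt = lt
<-length-drop (suc i) (x ∷ w) k lt = s≤s (<-length-drop i w k lt)

agree-restrict : ∀ s i j {n} d m → d + m ≤ n → Agree s i j n → Agree s (i + d) (j + d) m
agree-restrict s i j d m le ag k k<m
  rewrite +-assoc i d k | +-assoc j d k = ag (d + k) (<-≤-trans (+-monoʳ-< d k<m) le)

containsCube⇒cubeAt : ∀ w → ContainsCube w → ∃ λ i → ∃ λ p → CubeAt w i p
containsCube⇒cubeAt w (c , (X , X≢[] , refl) , u , v , refl) =
  length u , length X , pos X X≢[] , len , ag
  where
  pos : ∀ Y → ¬ (Y ≡ []) → 1 ≤ length Y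
  pos []      Y≢[] = ⊥-elim (Y≢[] refl)
  pos (_ ∷ _) _    = s≤s z≤n

  len : length u + (length X + (length X + length X)) ≤ length (u ++ ((X ++ (X ++ X)) ++ v))
  len rewrite length-++ u {(X ++ (X ++ X)) ++ v} | length-++ (X ++ (X ++ X)) {v}
            | length-++ X {X ++ X} | length-++ X {X}
    = +-monoʳ-≤ (length u) (m≤m+n _ (length v))

  ag : Agree (nth (u ++ ((X ++ (X ++ X)) ++ v))) (length u) (length u + length X) (length X + length X)
  -- XXX is read as XX followed by X and as X followed by XX; each reading yields letter k of XX.
  ag k lt = begin
    nth (u ++ ((X ++ (X ++ X)) ++ v)) (length u + k)              ≡⟨ nth-++ʳ u _ k ⟩
    nth ((X ++ (X ++ X)) ++ v) k                                  ≡⟨ cong (λ y → nth (y ++ v) k) (sym (++-assoc X X X)) ⟩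
    nth (((X ++ X) ++ X) ++ v) k                                  ≡⟨ cong (λ y → nth y k) (++-assoc (X ++ X) X v) ⟩
    nth ((X ++ X) ++ (X ++ v)) k                                  ≡⟨ nth-++ˡ (X ++ X) _ k k<XX ⟩
    nth (X ++ X) k                                                ≡⟨ nth-++ˡ (X ++ X) v k k<XX ⟨
    nth ((X ++ X) ++ v) k                                         ≡⟨ nth-++ʳ X _ k ⟨
    nth (X ++ ((X ++ X) ++ v)) (length X + k)                     ≡⟨ cong (λ y → nth y (length X + k)) (++-assoc X (X ++ X) v) ⟨
    nth ((X ++ (X ++ X)) ++ v) (length X + k)                     ≡⟨ nth-++ʳ u _ (length X + k) ⟨
    nth (u ++ ((X ++ (X ++ X)) ++ v)) (length u + (length X + k)) ≡⟨ cong (nth (u ++ ((X ++ (X ++ X)) ++ v))) (+-assoc (length u) (length X) k) ⟨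
    nth (u ++ ((X ++ (X ++ X)) ++ v)) (length u + length X + k)   ∎
    where
    open ≡-Reasoning
    k<XX : k < length (X ++ X)
    k<XX = subst (k <_) (sym (length-++ X)) lt

containsCube-++ʳ : ∀ w z → ContainsCube w → ContainsCube (w ++ z)
containsCube-++ʳ w z (c , cc , u , v , refl) =
  c , cc , u , v ++ z , trans (++-assoc u (c ++ v) z) (cong (u ++_) (++-assoc c v z))

containsCube-++ˡ : ∀ u w → ContainsCube w → ContainsCube (u ++ w)
containsCube-++ˡ u w (c , cc , u′ , v , refl) = c , cc , u ++ u′ , v , sym (++-assoc u u′ (c ++ v))

-- Deciding the presence of cubes

someBelow : (ℕ → Bool) → ℕ → Bool
someBelow f zero    = false
someBelow f (suc n) = f n ∨ someBelow f n

everyBelow : (ℕ → Bool) → ℕ → Bool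
everyBelow f n = not (someBelow (not ∘ f) n)

someBelow-sound : ∀ f n → T (someBelow f n) → ∃ λ k → k < n × T (f k)
someBelow-sound f (suc n) h with ⇒ T-∨ h
... | inj₁ fn = n , n<1+n n , fn
... | inj₂ h′ with someBelow-sound f n h′
...   | k , k<n , fk = k , m<n⇒m<1+n k<n , fk

someBelow-complete : ∀ f n k → k < n → T (f k) → T (someBelow f n)
someBelow-complete f (suc n) k k<1+n fk with m≤n⇒m<n∨m≡n (s≤s⁻¹ k<1+n)
... | inj₁ k<n  = ⇐ T-∨ (inj₂ (someBelow-complete f n k k<n fk))
... | inj₂ refl = ⇐ T-∨ (inj₁ fk)

T-not-elim : ∀ {b} → T (not b) → ¬ T b
T-not-elim {false} _ ()

T-not-intro : ∀ {b} → ¬ T b → T (not b)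
T-not-intro {false} _  = tt
T-not-intro {true}  ¬t = ¬t tt

everyBelow-sound : ∀ f n → T (everyBelow f n) → ∀ k → k < n → T (f k)
everyBelow-sound f n h k k<n with f k in eq
... | true  = tt
... | false = T-not-elim h (someBelow-complete (not ∘ f) n k k<n (subst (T ∘ not) (sym eq) tt))

everyBelow-complete : ∀ f n → (∀ k → k < n → T (f k)) → T (everyBelow f n)
everyBelow-complete f n h = T-not-intro λ some →
  let k , k<n , nfk = someBelow-sound (not ∘ f) n some in T-not-elim nfk (h k k<n)

-- The flag is the answer once one of the words is exhausted: with true, only a
-- visible mismatch counts against agreement.
agree : Bool → ℕ → Word → Word → Bool
agree e zero    _       _       = true
agree e (suc n) []      _       = e
agree e (suc n) (_ ∷ _) []      = e
agree e (suc n) (x ∷ u) (y ∷ v) = ⌊ x Bool.≟ y ⌋ ∧ agree e n u v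

agree-complete : ∀ e n u v → (∀ k → k < n → k < length u → k < length v → nth u k ≡ nth v k) →
                 T e ⊎ (n ≤ length u × n ≤ length v) → T (agree e n u v)
agree-complete e zero    _       _       _ _                = tt
agree-complete e (suc n) []      _       _ (inj₁ t)         = t
agree-complete e (suc n) []      _       _ (inj₂ (() , _))
agree-complete e (suc n) (_ ∷ _) []      _ (inj₁ t)         = t
agree-complete e (suc n) (_ ∷ _) []      _ (inj₂ (_ , ()))
agree-complete e (suc n) (x ∷ u) (y ∷ v) h r =
  ⇐ T-∧ ( fromWitness (h 0 z<s z<s z<s)
        , agree-complete e n u v (λ k a b c → h (suc k) (s<s a) (s<s b) (s<s c)) (shorter r))
  where
  shorter : T e ⊎ (suc n ≤ suc (length u) × suc n ≤ suc (length v)) → T e ⊎ (n ≤ length u × n ≤ length v)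
  shorter (inj₁ t)               = inj₁ t
  shorter (inj₂ (s≤s a , s≤s b)) = inj₂ (a , b)

-- With the flag `false` an exhausted word counts as disagreement, so neither word can be empty
-- while letters remain to be compared.
agree-take : ∀ m n u v → T (agree false (m + n) u v) → take m u ≡ take m v
agree-take zero    n u       v       _ = refl
agree-take (suc m) n (x ∷ u) (y ∷ v) h =
  let x≡y , h′ = ⇒ T-∧ h in cong₂ _∷_ (toWitness x≡y) (agree-take m n u v h′)

agree-drop : ∀ m n u v → T (agree false (m + n) u v) → T (agree false n (drop m u) (drop m v))
agree-drop zero    n u       v       h = h
agree-drop (suc m) n (x ∷ u) (y ∷ v) h = agree-drop m n u v (proj₂ (⇒ (T-∧ {⌊ x Bool.≟ y ⌋}) h))

prefixCube : Bool → ℕ → Word → Bool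
prefixCube e Q w = someBelow (λ p → agree e (suc p + suc p) w (drop (suc p) w)) Q

-- `S` limits the starting positions and `Q` the period. With the flag `true`, letters beyond the
-- end of the word may be whatever completes a cube.
cubeWithin : Bool → ℕ → ℕ → Word → Bool
cubeWithin e zero    Q w       = false
cubeWithin e (suc S) Q []      = e
cubeWithin e (suc S) Q (x ∷ w) = cubeWithin e S Q w ∨ prefixCube e Q (x ∷ w)

hasCube : Word → Bool
hasCube w = cubeWithin false (length w) (length w / 3) w

prefixCube-sound : ∀ Q w → T (prefixCube false Q w) → ContainsCube w
prefixCube-sound Q w h = let p , _ , h′ = someBelow-sound _ Q h in prefix p w h′
  where
  prefix : ∀ p y → T (agree false (suc p + suc p) y (drop (suc p) y)) → ContainsCube y
  prefix p (x ∷ y) h = X ++ (X ++ X) , (X , (λ ()) , refl) , [] , drop (suc p) z′ , (begin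
    x ∷ y                                     ≡⟨ take++drop≡id (suc p) (x ∷ y) ⟨
    X ++ z                                    ≡⟨ cong (X ++_) (take++drop≡id (suc p) z) ⟨
    X ++ (take (suc p) z ++ z′)               ≡⟨ cong (λ r → X ++ (take (suc p) z ++ r)) (take++drop≡id (suc p) z′) ⟨
    X ++ (take (suc p) z ++ (take (suc p) z′ ++ drop (suc p) z′))
      ≡⟨ cong₂ (λ a b → X ++ (a ++ (b ++ drop (suc p) z′))) (sym X≡z) (sym (trans X≡z z≡z′)) ⟩
    X ++ (X ++ (X ++ drop (suc p) z′))        ≡⟨ cong (X ++_) (++-assoc X X _) ⟨
    X ++ ((X ++ X) ++ drop (suc p) z′)        ≡⟨ ++-assoc X (X ++ X) _ ⟨
    (X ++ (X ++ X)) ++ drop (suc p) z′        ∎)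
    where
    open ≡-Reasoning
    X z z′ : Word
    X  = take (suc p) (x ∷ y)
    z  = drop (suc p) (x ∷ y)
    z′ = drop (suc p) z
    -- The first half of the agreement identifies the first two copies of X, the second half the
    -- last two.
    X≡z : X ≡ take (suc p) z
    X≡z = agree-take (suc p) (suc p) (x ∷ y) z h
    z≡z′ : take (suc p) z ≡ take (suc p) z′
    z≡z′ = agree-take (suc p) 0 z z′
      (subst (λ n → T (agree false n z z′)) (sym (+-identityʳ (suc p))) (agree-drop (suc p) (suc p) (x ∷ y) z h))

cubeWithin-sound : ∀ S Q w → T (cubeWithin false S Q w) → ContainsCube w
cubeWithin-sound (suc S) Q (x ∷ w) h with ⇒ (T-∨ {cubeWithin false S Q w}) h
... | inj₂ h′ = prefixCube-sound Q (x ∷ w) h′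
... | inj₁ h′ = containsCube-++ˡ (x ∷ []) w (cubeWithin-sound S Q w h′)

-- A cube of a word z extending y is visible in y, up to letters of y not yet known.
cubeWithin-complete : ∀ e S Q y i p → i < S → 1 ≤ p → p ≤ Q →
  (∀ k → k < p + p → i + p + k < length y → nth y (i + k) ≡ nth y (i + p + k)) →
  T e ⊎ i + (p + (p + p)) ≤ length y → T (cubeWithin e S Q y)
cubeWithin-complete e (suc S) Q []      _       _       _ _   _ _  (inj₁ t)  = t
cubeWithin-complete e (suc S) Q []      zero    (suc p) _ _   _ _  (inj₂ ())
cubeWithin-complete e (suc S) Q (x ∷ y) (suc i) p (s≤s i<S) 1≤p p≤Q ag r =
  ⇐ T-∨ (inj₁ (cubeWithin-complete e S Q y i p i<S 1≤p p≤Q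
    (λ k k< lt → ag k k< (s≤s lt)) (map₂ s≤s⁻¹ r)))
cubeWithin-complete e (suc S) Q (x ∷ y) zero    (suc p) _ _ p<Q ag r =
  ⇐ (T-∨ {cubeWithin e S Q y}) (inj₂ (someBelow-complete _ Q p p<Q (agree-complete e n w (drop (suc p) w) letters (map₂ long r))))
  where
  n : ℕ
  n = suc p + suc p
  w : Word
  w = x ∷ y
  letters : ∀ k → k < n → k < length w → k < length (drop (suc p) w) → nth w k ≡ nth (drop (suc p) w) k
  letters k k<n _ lt = trans (ag k k<n (<-length-drop (suc p) w k lt)) (sym (nth-drop (suc p) w k))
  long : suc p + n ≤ length w → n ≤ length w × n ≤ length (drop (suc p) w)
  long le = m+n≤o⇒n≤o (suc p) le ,
    subst (n ≤_) (sym (length-drop (suc p) w)) (m+n≤o⇒m≤o∸n n (subst (_≤ length w) (+-comm (suc p) n) le))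

cubeAt-within : ∀ S Q w i p → i < S → p ≤ Q → CubeAt w i p → T (cubeWithin false S Q w)
cubeAt-within S Q w i p i<S p≤Q (1≤p , len , ag) =
  cubeWithin-complete false S Q w i p i<S 1≤p p≤Q (λ k k< _ → ag k k<) (inj₂ len)

-- The bounds built into `hasCube` lose no cube: a nonempty cube starts inside the word, and three
-- periods fit into its length.
cubeAt⇒hasCube : ∀ w i p → CubeAt w i p → T (hasCube w)
cubeAt⇒hasCube w i p c@(1≤p , len , _) = cubeAt-within (length w) (length w / 3) w i p i<w p≤w/3 c
  where
  i<w : i < length w
  i<w = <-≤-trans (m<m+n i (≤-trans 1≤p (m≤m+n p (p + p)))) len
  p≤w/3 : p ≤ length w / 3
  p≤w/3 = subst (_≤ length w / 3) (m*n/n≡m p 3)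
    (/-monoˡ-≤ 3 (≤-trans (≤-reflexive (triple p)) (≤-trans (m≤n+m _ i) len)))
    where
    triple : ∀ p → p * 3 ≡ p + (p + p)
    triple = solve-∀

hasCube-sound : ∀ w → T (hasCube w) → ContainsCube w
hasCube-sound w = cubeWithin-sound (length w) (length w / 3) w

hasCube-complete : ∀ w → ContainsCube w → T (hasCube w)
hasCube-complete w c = let i , p , at = containsCube⇒cubeAt w c in cubeAt⇒hasCube w i p at

-- Discharges those cases of the finite checks below in which the given pattern already has a cube.
cubeful : ∀ {A : Set} x → T (hasCube x) → CubeFree x → A
cubeful x h cf = ⊥-elim (cf (hasCube-sound x h))

cubeAt⇒containsCube : ∀ w i p → CubeAt w i p → ContainsCube w
cubeAt⇒containsCube w i p = hasCube-sound w ∘ cubeAt⇒hasCube w i p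

-- Deciding irreducibility

removalsCubeful : ℕ → ℕ → Word → Bool
removalsCubeful a n w = everyBelow (λ i → hasCube (removeAt (a + i) w)) n

removalsCubeful-sound : ∀ a n w → T (removalsCubeful a n w) →
                        ∀ i → a ≤ i → i < a + n → ContainsCube (removeAt i w)
removalsCubeful-sound a n w h i a≤i i<a+n =
  subst (λ i → ContainsCube (removeAt i w)) (m+[n∸m]≡n a≤i)
    (hasCube-sound (removeAt (a + (i ∸ a)) w)
      (everyBelow-sound (λ i → hasCube (removeAt (a + i) w)) n h (i ∸ a)
        (+-cancelˡ-< a _ _ (subst (_< a + n) (sym (m+[n∸m]≡n a≤i)) i<a+n))))

-- The interior indices run from 1 to `length w ∸ 2`.
isIrreducible : Word → Bool
isIrreducible w = not (hasCube w) ∧ ⌊ 3 ≤? length w ⌋ ∧ removalsCubeful 1 (length w ∸ 2) w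

isIrreducible-sound : ∀ w → T (isIrreducible w) → IrreducibleCubeFree w
isIrreducible-sound w h =
  let nc , h′ = ⇒ T-∧ h; l , ev = ⇒ (T-∧ {⌊ 3 ≤? length w ⌋}) h′ in
  T-not-elim nc ∘ hasCube-complete w , toWitness l ,
  λ i 1≤i i< → removalsCubeful-sound 1 (length w ∸ 2) w ev i 1≤i (s≤s (pred-interior i 1≤i i<))
  where
  pred-interior : ∀ i → 1 ≤ i → suc i < length w → i ≤ length w ∸ 2
  pred-interior (suc i) _ i< = ∸-monoˡ-≤ 2 i<

isIrreducible-complete : ∀ w → IrreducibleCubeFree w → T (isIrreducible w)
isIrreducible-complete w (cf , l , ev) =
  ⇐ T-∧ ( T-not-intro (cf ∘ hasCube-sound w)
        , ⇐ T-∧ (fromWitness l , everyBelow-complete _ (length w ∸ 2) interior))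
  where
  interior : ∀ i → i < length w ∸ 2 → T (hasCube (removeAt (suc i) w))
  interior i i< = hasCube-complete _ (ev (suc i) (s≤s z≤n) (subst (_≤ length w) (+-comm (suc i) 2)
    (≤-trans (+-monoˡ-≤ 2 i<) (≤-reflexive (m∸n+n≡m (≤-trans (n≤1+n 2) l))))))

-- Removal of a letter: concatenation, length and letters

removeAt-++ʳ : ∀ u w i → removeAt (length u + i) (u ++ w) ≡ u ++ removeAt i w
removeAt-++ʳ []      w i = refl
removeAt-++ʳ (x ∷ u) w i = cong (x ∷_) (removeAt-++ʳ u w i)

removeAt-++ˡ : ∀ w z i → i < length w → removeAt i (w ++ z) ≡ removeAt i w ++ z
removeAt-++ˡ (x ∷ w) z zero    _         = refl
removeAt-++ˡ (x ∷ w) z (suc i) (s≤s i<w) = cong (x ∷_) (removeAt-++ˡ w z i i<w)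

length-removeAt : ∀ i (w : Word) → i < length w → suc (length (removeAt i w)) ≡ length w
length-removeAt zero    (x ∷ w) _         = refl
length-removeAt (suc i) (x ∷ w) (s≤s i<w) = cong suc (length-removeAt i w i<w)

nth-removeAt : ∀ i w k → nth (removeAt i w) (i + k) ≡ nth w (suc (i + k))
nth-removeAt zero    []      k = refl
nth-removeAt zero    (x ∷ w) k = refl
nth-removeAt (suc i) []      k = refl
nth-removeAt (suc i) (x ∷ w) k = nth-removeAt i w k

-- Words of length at most 21

Admissible : ℕ → Set
Admissible n = n ≡ 10 ⊎ n ≡ 14 ⊎ n ≡ 18 ⊎ n ≡ 19 ⊎ n ≡ 20 ⊎ 22 ≤ n

admissible? : ∀ n → Dec (Admissible n)
admissible? n =
  n ≟ 10 ⊎-dec n ≟ 14 ⊎-dec n ≟ 18 ⊎-dec n ≟ 19 ⊎-dec n ≟ 20 ⊎-dec 22 ≤? n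

-- A cube created by removing the letter at index i from a cubefree word starts
-- before i; in a word of length at most 20 its period is at most 6.
viable : ℕ → Word → Bool
viable i v = cubeWithin true i 6 (removeAt i v)

-- The last letter of `v` is not tested, because `v` may be the complete word, where that letter is
-- not interior.
doomed : Word → Bool
doomed v = hasCube v ∨ someBelow (λ i → not (viable (suc i) v)) (length v ∸ 2)

-- Certifies that, up to length 21, no extension of `v` by at most `k` letters is an irreducible
-- cubefree word of inadmissible length.
refuted : ℕ → Word → Bool
refuted-children : ℕ → Word → Bool
refuted k v =
  doomed v ∨ ((⌊ admissible? (length v) ⌋ ∨ not (isIrreducible v)) ∧ refuted-children k v)
refuted-children zero    v = true
refuted-children (suc k) v = refuted k (v ++ (false ∷ [])) ∧ refuted k (v ++ (true ∷ []))

removal-viable : ∀ v z i → length (v ++ z) ≤ 21 → CubeFree (v ++ z) → i < length v →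
                 ContainsCube (removeAt i (v ++ z)) → T (viable i v)
removal-viable v z i w≤21 cf i<v cc with containsCube⇒cubeAt _ cc
... | s , p , c@(1≤p , len , ag) with s <? i
...   | yes s<i = cubeWithin-complete true i 6 y s p s<i 1≤p p≤6 known (inj₁ tt)
  where
  y : Word
  y = removeAt i v
  i<w : i < length (v ++ z)
  i<w = <-≤-trans i<v (subst (length v ≤_) (sym (length-++ v)) (m≤m+n _ _))
  p≤6 : p ≤ 6
  p≤6 with p ≤? 6
  ... | yes q = q
  -- The removal leaves at most 20 letters, whereas three periods of at least 7 take 21.
  ... | no ¬q = ⊥-elim (<⇒≱ (s≤s (≤-trans (+-mono-≤ 7≤p (+-mono-≤ 7≤p 7≤p)) (≤-trans (m≤n+m _ s) len)))
                  (≤-trans (≤-reflexive (length-removeAt i (v ++ z) i<w)) w≤21))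
    where 7≤p = ≰⇒> ¬q
  known : ∀ k → k < p + p → s + p + k < length y → nth y (s + k) ≡ nth y (s + p + k)
  known k k< lt = begin
    nth y (s + k)             ≡⟨ nth-++ˡ y z (s + k) (≤-<-trans (+-monoˡ-≤ k (m≤m+n s p)) lt) ⟨
    nth (y ++ z) (s + k)      ≡⟨ subst (λ q → Agree (nth q) s (s + p) (p + p)) (removeAt-++ˡ v z i i<v) ag k k< ⟩
    nth (y ++ z) (s + p + k)  ≡⟨ nth-++ˡ y z (s + p + k) lt ⟩
    nth y (s + p + k)         ∎
    where open ≡-Reasoning
-- The cube lies entirely behind the removed letter, so it already occurs in the original word one
-- position later.
...   | no s≮i = ⊥-elim (cf (cubeAt⇒containsCube w (suc s) p (1≤p , len′ , ag′)))
  where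
  w : Word
  w = v ++ z
  i<w : i < length w
  i<w = <-≤-trans i<v (subst (length v ≤_) (sym (length-++ v)) (m≤m+n _ _))
  i≤s : i ≤ s
  i≤s = ≮⇒≥ s≮i
  later : ∀ j → i ≤ j → nth (removeAt i w) j ≡ nth w (suc j)
  later j i≤j = subst (λ m → nth (removeAt i w) m ≡ nth w (suc m)) (m+[n∸m]≡n i≤j) (nth-removeAt i w (j ∸ i))
  len′ : suc s + (p + (p + p)) ≤ length w
  len′ = ≤-trans (s≤s len) (≤-reflexive (length-removeAt i w i<w))
  ag′ : Agree (nth w) (suc s) (suc s + p) (p + p)
  ag′ k k< = trans (sym (later (s + k) (≤-trans i≤s (m≤m+n s k))))
    (trans (ag k k<) (later (s + p + k) (≤-trans i≤s (≤-trans (m≤m+n s p) (m≤m+n _ k)))))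

doomed-sound : ∀ v z → length (v ++ z) ≤ 21 → IrreducibleCubeFree (v ++ z) → ¬ T (doomed v)
doomed-sound v z w≤21 (cf , _ , ev) h with ⇒ T-∨ h
... | inj₁ c = cf (containsCube-++ʳ v z (hasCube-sound v c))
... | inj₂ s with someBelow-sound _ (length v ∸ 2) s
...   | i , i< , nv = T-not-elim nv (removal-viable v z (suc i) w≤21 cf (<-trans (n<1+n _) 2+i<v)
                        (ev (suc i) (s≤s z≤n) (<-≤-trans 2+i<v v≤w)))
  where
  2+i<v : suc (suc i) < length v
  2+i<v = subst (_≤ length v) (+-comm (suc i) 2)
    (≤-trans (+-monoˡ-≤ 2 i<) (≤-reflexive (m∸n+n≡m {_} {2} (<⇒≤ (m∸n≢0⇒n<m λ eq → n≮0 (subst (i <_) eq i<))))))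
  v≤w : length v ≤ length (v ++ z)
  v≤w = subst (length v ≤_) (sym (length-++ v)) (m≤m+n _ _)

-- The letters of `z` spell a path in the search tree. No node on it is doomed, as each is a prefix
-- of an irreducible word, so the path ends at the word itself and the test made there applies.
refuted-sound : ∀ k v z → length z ≤ k → length (v ++ z) ≤ 21 → IrreducibleCubeFree (v ++ z) →
                T (refuted k v) → Admissible (length (v ++ z))
refuted-sound k v z z≤k w≤21 irr h with ⇒ (T-∨ {doomed v}) h
... | inj₁ d = ⊥-elim (doomed-sound v z w≤21 irr d)
... | inj₂ h′ with ⇒ (T-∧ {⌊ admissible? (length v) ⌋ ∨ not (isIrreducible v)}) h′
refuted-sound k v [] z≤k w≤21 irr h | inj₂ h′ | here , _
  rewrite ++-identityʳ v with ⇒ (T-∨ {⌊ admissible? (length v) ⌋}) here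
... | inj₂ ni = ⊥-elim (T-not-elim ni (isIrreducible-complete v irr))
... | inj₁ ad = toWitness ad
refuted-sound (suc k) v (b ∷ z) (s≤s z≤k) w≤21 irr h | inj₂ h′ | _ , ch
  rewrite sym (++-assoc v (b ∷ []) z) =
  refuted-sound k (v ++ (b ∷ [])) z z≤k w≤21 irr (child b (⇒ (T-∧ {refuted k (v ++ (false ∷ []))}) ch))
  where
  child : ∀ b → T (refuted k (v ++ (false ∷ []))) × T (refuted k (v ++ (true ∷ []))) → T (refuted k (v ++ (b ∷ [])))
  child false = proj₁
  child true  = proj₂

short-admissible : ∀ w → length w ≤ 21 → IrreducibleCubeFree w → Admissible (length w)
-- The final `tt` is accepted because `refuted 21 []` evaluates to `true`; this runs the whole
-- search.
short-admissible w w≤21 irr = refuted-sound 21 [] w w≤21 w≤21 irr tt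

-- Overlap-freeness of the Thue–Morse sequence

odd : ℕ → Bool
odd zero    = false
odd (suc n) = not (odd n)

-- The first argument is fuel; any value at least the second will do.
digitParity : ℕ → ℕ → Bool
digitParity zero    n = false
digitParity (suc f) n = odd n xor digitParity f ⌊ n /2⌋

thueMorse : ℕ → Bool
thueMorse n = digitParity n n

digitParity-fuel : ∀ f g n → n ≤ f → n ≤ g → digitParity f n ≡ digitParity g n
digitParity-fuel zero    zero    _       _        _   = refl
digitParity-fuel zero    (suc g) zero    _        _   = digitParity-fuel zero g zero z≤n z≤n
digitParity-fuel (suc f) zero    zero    _        _   = digitParity-fuel f zero zero z≤n z≤n
digitParity-fuel (suc f) (suc g) zero    _        _   = digitParity-fuel f g zero z≤n z≤n
digitParity-fuel (suc f) (suc g) (suc n) (s≤s n≤f) (s≤s n≤g) =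
  cong (odd (suc n) xor_) (digitParity-fuel f g ⌊ suc n /2⌋ (≤-trans half n≤f) (≤-trans half n≤g))
  where
  half : ⌊ suc n /2⌋ ≤ n
  half = s≤s⁻¹ (⌊n/2⌋<n n)

thueMorse-unfold : ∀ n → thueMorse n ≡ odd n xor thueMorse ⌊ n /2⌋
-- One spare unit of fuel exposes the recursion, also at 0.
thueMorse-unfold n = trans (digitParity-fuel n (suc n) n ≤-refl (n≤1+n n))
  (cong (odd n xor_) (digitParity-fuel n ⌊ n /2⌋ ⌊ n /2⌋ (⌊n/2⌋≤n n) ≤-refl))

odd-double : ∀ n → odd (n + n) ≡ false
odd-double zero    = refl
odd-double (suc n) rewrite +-suc n n = trans (not-involutive (odd (n + n))) (odd-double n)

thueMorse-even : ∀ n → thueMorse (n + n) ≡ thueMorse n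
thueMorse-even n = trans (thueMorse-unfold (n + n))
  (cong₂ (λ b m → b xor thueMorse m) (odd-double n) (sym (n≡⌊n+n/2⌋ n)))

thueMorse-odd : ∀ n → thueMorse (suc (n + n)) ≡ not (thueMorse n)
thueMorse-odd n = trans (thueMorse-unfold (suc (n + n)))
  (cong₂ (λ b m → not b xor thueMorse m) (odd-double n) (sym (n≡⌈n+n/2⌉ n)))

-- This and the next two are the recurrences at later indices, with the successors in front to match
-- `k + (m + m)` for numerals k.
thueMorse-even₁ : ∀ n → thueMorse (2 + (n + n)) ≡ thueMorse (1 + n)
thueMorse-even₁ n = trans (cong (thueMorse ∘ suc) (sym (+-suc n n))) (thueMorse-even (suc n))

thueMorse-odd₁ : ∀ n → thueMorse (3 + (n + n)) ≡ not (thueMorse (1 + n))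
thueMorse-odd₁ n = trans (cong (thueMorse ∘ suc ∘ suc) (sym (+-suc n n))) (thueMorse-odd (suc n))

thueMorse-even₂ : ∀ n → thueMorse (4 + (n + n)) ≡ thueMorse (2 + n)
thueMorse-even₂ n = trans (cong (thueMorse ∘ suc ∘ suc ∘ suc) (sym (+-suc n n))) (thueMorse-even₁ (suc n))

halve : ∀ n → ∃ λ m → n ≡ m + m ⊎ n ≡ suc (m + m)
halve zero = 0 , inj₁ refl
halve (suc n) with halve n
... | m , inj₁ refl = m , inj₂ refl
... | m , inj₂ refl = suc m , inj₁ (cong suc (sym (+-suc m m)))

-- One of the two adjacent pairs starts at an even index 2m, and the letters at 2m and 2m + 1 always
-- differ.
thueMorse-no-triple : ∀ c → thueMorse c ≡ thueMorse (1 + c) → ¬ (thueMorse (1 + c) ≡ thueMorse (2 + c))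
thueMorse-no-triple c e₀ e₁ with halve c
... | m , inj₁ refl = not-¬ refl (trans (sym (thueMorse-even m)) (trans e₀ (thueMorse-odd m)))
... | m , inj₂ refl = not-¬ refl (trans (sym (thueMorse-even₁ m)) (trans e₁ (thueMorse-odd₁ m)))

-- The excluded agreement describes a factor of length 2q + 1 with period q, that is, an overlap.
OverlapFree : (ℕ → Bool) → Set
OverlapFree s = ∀ b q → 1 ≤ q → ¬ Agree s b (b + q) (suc q)

-- Writing t for the sequence, the first two equations give t(c) = not t(m) = t(c + 1), and the
-- other two give t(c + 1) = not t(m + 1) = t(c + 2): three equal letters in a row.
thueMorse-odd-shift : ∀ m c →
  (∀ k → k < 4 → thueMorse (k + (m + m)) ≡ thueMorse (k + suc (c + c))) → ⊥
thueMorse-odd-shift m c e = thueMorse-no-triple c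
  (trans (flip (t m) (t c) (trans (sym (thueMorse-even m)) (trans (e 0 z<s) (thueMorse-odd c))))
    (trans (sym (thueMorse-odd m)) (trans (e 1 (s<s z<s)) (thueMorse-even₁ c))))
  (trans (flip (t (1 + m)) (t (1 + c))
           (trans (sym (thueMorse-even₁ m)) (trans (e 2 (s<s (s<s z<s))) (thueMorse-odd₁ c))))
    (trans (sym (thueMorse-odd₁ m)) (trans (e 3 (s<s (s<s (s<s z<s)))) (thueMorse-even₂ c))))
  where
  t : ℕ → Bool
  t = thueMorse
  flip : ∀ x y → x ≡ not y → y ≡ not x
  flip x y eq = trans (sym (not-involutive y)) (cong not (sym eq))

-- Strong induction on the period q. If q is even, every second agreement gives an overlap of period
-- q / 2. If q = 1, three equal letters occur. If q is odd and at least 3, four consecutive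
-- agreements match indices of opposite parity.
thueMorse-overlapFree : OverlapFree thueMorse
thueMorse-overlapFree b q = <-rec Q step q b
  where
  t : ℕ → Bool
  t = thueMorse

  Q : ℕ → Set
  Q q = ∀ b → 1 ≤ q → ¬ Agree t b (b + q) (suc q)

  dbl : ∀ m k → (m + m) + (k + k) ≡ (m + k) + (m + k)
  dbl = solve-∀
  dbl₃ : ∀ m r k → (m + m) + (r + r) + (k + k) ≡ (m + r + k) + (m + r + k)
  dbl₃ = solve-∀
  shift₀ : ∀ m r → (m + m) + suc (r + r) ≡ suc ((m + r) + (m + r))
  shift₀ = solve-∀
  shift₁ : ∀ m r → suc (m + m) + suc (r + r) ≡ suc (m + r) + suc (m + r)
  shift₁ = solve-∀

  front : ∀ i j {n} → Agree t i j n → ∀ k → k < n → t (k + i) ≡ t (k + j)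
  front i j ag k k<n = trans (cong t (+-comm k i)) (trans (ag k k<n) (cong t (+-comm j k)))

  2k<2r+1 : ∀ {k r} → k < suc r → k + k < suc (r + r)
  2k<2r+1 (s≤s k≤r) = s≤s (+-mono-≤ k≤r k≤r)

  4≤ : ∀ r → 4 ≤ suc (suc (suc r + suc r))
  4≤ r rewrite +-suc r r = s≤s (s≤s (s≤s (s≤s z≤n)))

  step : ∀ q → (∀ {r} → r < q → Q r) → Q q
  step q rec b 1≤q ag with halve q | halve b
  step q rec b ()  ag | zero , inj₁ refl | _
  ... | suc r , inj₁ refl | m , inj₁ refl = rec (s≤s (m≤n+m (suc r) r)) m (s≤s z≤n) λ k k< →
    trans (sym (thueMorse-even (m + k))) (trans (cong t (sym (dbl m k))) (trans (ag (k + k) (2k<2r+1 k<))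
      (trans (cong t (dbl₃ m (suc r) k)) (thueMorse-even (m + suc r + k)))))
  ... | suc r , inj₁ refl | m , inj₂ refl = rec (s≤s (m≤n+m (suc r) r)) m (s≤s z≤n) λ k k< → not-injective
    (trans (sym (thueMorse-odd (m + k))) (trans (cong (t ∘ suc) (sym (dbl m k))) (trans (ag (k + k) (2k<2r+1 k<))
      (trans (cong (t ∘ suc) (dbl₃ m (suc r) k)) (thueMorse-odd (m + suc r + k))))))
  ... | zero , inj₂ refl | _ = thueMorse-no-triple b
    (trans (front b (b + 1) ag 0 z<s) (cong t (+-comm b 1)))
    (trans (front b (b + 1) ag 1 (s<s z<s)) (cong (t ∘ suc) (+-comm b 1)))
  ... | suc r , inj₂ refl | m , inj₁ refl = thueMorse-odd-shift m (m + suc r) λ k k<4 →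
    trans (front (m + m) _ ag k (<-≤-trans k<4 (4≤ r))) (cong (λ j → t (k + j)) (shift₀ m (suc r)))
  -- Here b is odd and b + q is even, so the two sides exchange roles.
  ... | suc r , inj₂ refl | m , inj₂ refl = thueMorse-odd-shift (suc (m + suc r)) m λ k k<4 →
    sym (trans (front (suc (m + m)) _ ag k (<-≤-trans k<4 (4≤ r))) (cong (λ j → t (k + j)) (shift₁ m (suc r))))

overlapFree-shift : ∀ s a → OverlapFree s → OverlapFree (λ i → s (a + i))
overlapFree-shift s a of b q 1≤q ag = of (a + b) q 1≤q λ k k< →
  trans (cong s (+-assoc a b k)) (trans (ag k k<) (cong s (assoc₄ a b q k)))
  where
  assoc₄ : ∀ a b q k → a + (b + q + k) ≡ a + b + q + k
  assoc₄ = solve-∀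

nth-applyUpTo : ∀ s n k → k < n → nth (applyUpTo s n) k ≡ s k
nth-applyUpTo s (suc n) zero    _         = refl
nth-applyUpTo s (suc n) (suc k) (s≤s k<n) = nth-applyUpTo (s ∘ suc) n k k<n

-- A cube of period p contains an overlap of period p, as p + 1 ≤ 2p.
overlapFree⇒cubeFree : ∀ s → OverlapFree s → ∀ n → CubeFree (applyUpTo s n)
overlapFree⇒cubeFree s of n c with containsCube⇒cubeAt _ c
... | i , p , 1≤p , len , ag = of i p 1≤p λ k k<1+p →
  let k<2p = <-≤-trans k<1+p (+-monoˡ-≤ p 1≤p) in
  trans (sym (nth-applyUpTo s n (i + k) (≤-<-trans (+-monoˡ-≤ k (m≤m+n i p)) (inside k k<2p))))
    (trans (ag k k<2p) (nth-applyUpTo s n (i + p + k) (inside k k<2p)))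
  where
  inside : ∀ k → k < p + p → i + p + k < n
  inside k k<2p = <-≤-trans (+-monoʳ-< (i + p) k<2p)
    (subst (i + p + (p + p) ≤_) (length-applyUpTo s n)
      (≤-trans (≤-reflexive (+-assoc i p (p + p))) len))

-- Expansion by a synchronizing 17-uniform morphism

word : String → Word
word s = map (λ c → charCode c ≡ᵇ codeOfOne) (toList s)
  where
  codeOfOne : ℕ
  codeOfOne = 49

block : Bool → Word
block false = word "01011001010011010"
block true  = word "01011001001011010"

-- A common prefix of the two blocks.
end : Word
end = word "010"

image : Word → Word → Word
image []      e = e
image (b ∷ x) e = block b ++ image x e

-- The infinite image of `s`, given letter by letter so that periods can be treated without lengths
-- of lists.
expand : (ℕ → Bool) → ℕ → Bool
expand s i = nth (block (s (i / 17))) (i % 17)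

length-block : ∀ b → length (block b) ≡ 17
length-block false = refl
length-block true  = refl

length-image : ∀ x e → length (image x e) ≡ length x * 17 + length e
length-image []      e = refl
length-image (b ∷ x) e = trans (length-++ (block b))
  (cong₂ _+_ (length-block b) (length-image x e))

image-end : ∀ x e → image x e ≡ image x [] ++ e
image-end []      e = refl
image-end (b ∷ x) e = trans (cong (block b ++_) (image-end x e)) (sym (++-assoc (block b) (image x []) e))

expand-head : ∀ s r → r < 17 → expand s r ≡ nth (block (s 0)) r
expand-head s r r<17 = cong₂ (λ q m → nth (block (s q)) m) (m<n⇒m/n≡0 r<17) (m<n⇒m%n≡m r<17)

expand-shift : ∀ s a j → expand s (a * 17 + j) ≡ expand (λ i → s (a + i)) j
expand-shift s a j = cong₂ (λ q m → nth (block (s q)) m)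
  (trans (+-distrib-/-∣ˡ j (n∣m*n a)) (cong (_+ j / 17) (m*n/n≡m a 17)))
  (trans (cong (_% 17) (+-comm (a * 17) j)) ([m+kn]%n≡m%n j a 17))

-- `end` is a prefix of either block, so it agrees with the expansion whatever letter of `s` comes
-- next.
nth-image : ∀ s k j → j < length (image (applyUpTo s k) end) →
            nth (image (applyUpTo s k) end) j ≡ expand s j
nth-image s zero    j j< = trans (common (s 0) j j<) (sym (expand-head s j (<-≤-trans (m<n⇒m<1+n j<) (m≤m+n 4 13))))
  where
  common : ∀ b j → j < 3 → nth end j ≡ nth (block b) j
  common false 0 _ = refl
  common false 1 _ = refl
  common false 2 _ = refl
  common true  0 _ = refl
  common true  1 _ = refl
  common true  2 _ = refl
  common _ (suc (suc (suc _))) (s≤s (s≤s (s≤s ())))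
nth-image s (suc k) j j< with j <? 17
... | yes j<17 = trans (nth-++ˡ (block (s 0)) _ j (subst (j <_) (sym (length-block (s 0))) j<17))
                   (sym (expand-head s j j<17))
... | no j≮17 = begin
  nth (image (applyUpTo s (suc k)) end) j              ≡⟨ cong (nth (image (applyUpTo s (suc k)) end)) j≡ ⟩
  nth (block (s 0) ++ rest) (length (block (s 0)) + i) ≡⟨ nth-++ʳ (block (s 0)) rest i ⟩
  nth rest i                                           ≡⟨ nth-image (s ∘ suc) k i i< ⟩
  expand (s ∘ suc) i                                   ≡⟨ expand-shift s 1 i ⟨
  expand s (17 + i)                                    ≡⟨ cong (expand s) (m+[n∸m]≡n (≮⇒≥ j≮17)) ⟩
  expand s j                                           ∎
  where
  open ≡-Reasoning
  rest : Word
  rest = image (applyUpTo (s ∘ suc) k) end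
  i : ℕ
  i = j ∸ 17
  j≡ : j ≡ length (block (s 0)) + i
  j≡ = trans (sym (m+[n∸m]≡n (≮⇒≥ j≮17))) (cong (_+ i) (sym (length-block (s 0))))
  i< : i < length rest
  i< = +-cancelˡ-< (length (block (s 0))) i (length rest)
    (subst (length (block (s 0)) + i <_) (length-++ (block (s 0))) (subst (_< length (image (applyUpTo s (suc k)) end)) j≡ j<))

-- The offsets 1 to 16 are those that miss the block boundaries. Each of the eight choices of
-- letters is a closed computation.
blocks-synchronized : ∀ x y z d → d < 16 → ¬ T (agree false 17 (block x) (drop (suc d) (image (y ∷ z ∷ []) end)))
blocks-synchronized x y z d d<16 = check x y z d d<16
  where
  mismatch : Word → Word → ℕ → Bool
  mismatch u v d = not (agree false 17 u (drop (suc d) v))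

  ok : ∀ u v → T (everyBelow (mismatch u v) 16) → ∀ d → d < 16 → ¬ T (agree false 17 u (drop (suc d) v))
  ok u v h d d<16 = T-not-elim (everyBelow-sound (mismatch u v) 16 h d d<16)

  check : ∀ x y z d → d < 16 → ¬ T (agree false 17 (block x) (drop (suc d) (image (y ∷ z ∷ []) end)))
  check false false false = ok (block false) (image (false ∷ false ∷ []) end) tt
  check false false true  = ok (block false) (image (false ∷ true ∷ []) end) tt
  check false true  false = ok (block false) (image (true ∷ false ∷ []) end) tt
  check false true  true  = ok (block false) (image (true ∷ true ∷ []) end) tt
  check true  false false = ok (block true) (image (false ∷ false ∷ []) end) tt
  check true  false true  = ok (block true) (image (false ∷ true ∷ []) end) tt
  check true  true  false = ok (block true) (image (true ∷ false ∷ []) end) tt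
  check true  true  true  = ok (block true) (image (true ∷ true ∷ []) end) tt

-- The first block reappears at position p. Were p not a multiple of 17, it would occur in a
-- two-letter image at the offset p % 17, against synchronization.
period-multiple : ∀ s p n → 17 ≤ n → Agree (expand s) 0 p n → ∃ λ q → p ≡ q * 17
period-multiple s p n 17≤n ag with p % 17 in eq
... | zero  = p / 17 , subst (λ d → p ≡ d + p / 17 * 17) eq (m≡m%n+[m/n]*n p 17)
... | suc d = ⊥-elim (blocks-synchronized (s 0) (s (c + 0)) (s (c + 1)) d d<16
    (agree-complete false 17 (block (s 0)) (drop (suc d) window) letters
      (inj₂ (≤-reflexive (sym (length-block (s 0))) , 17≤drop))))
  where
  c : ℕ
  c = p / 17
  s′ : ℕ → Bool
  s′ i = s (c + i)
  window : Word
  window = image (applyUpTo s′ 2) end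
  length-window : length window ≡ 37
  length-window = length-image (applyUpTo s′ 2) end
  d<16 : d < 16
  d<16 = s≤s⁻¹ (subst (_< 17) eq (m%n<n p 17))
  17≤drop : 17 ≤ length (drop (suc d) window)
  -- An offset of at most 16 leaves at least 21 of the 37 letters.
  17≤drop = ≤-trans (≤-trans (m≤m+n 17 4) (∸-monoʳ-≤ 37 d<16))
    (≤-reflexive (sym (trans (length-drop (suc d) window) (cong (_∸ suc d) length-window))))
  arith : ∀ d c k → d + c * 17 + k ≡ c * 17 + (d + k)
  arith = solve-∀
  p≡ : p ≡ suc d + c * 17
  p≡ = subst (λ d → p ≡ d + c * 17) eq (m≡m%n+[m/n]*n p 17)
  letters : ∀ k → k < 17 → k < length (block (s 0)) → k < length (drop (suc d) window) →
            nth (block (s 0)) k ≡ nth (drop (suc d) window) k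
  letters k k<17 _ k<drop = begin
    nth (block (s 0)) k             ≡⟨ expand-head s k k<17 ⟨
    expand s k                      ≡⟨ ag k (<-≤-trans k<17 17≤n) ⟩
    expand s (p + k)                ≡⟨ cong (λ p → expand s (p + k)) p≡ ⟩
    expand s (suc d + c * 17 + k)   ≡⟨ cong (expand s) (arith (suc d) c k) ⟩
    expand s (c * 17 + (suc d + k)) ≡⟨ expand-shift s c (suc d + k) ⟩
    expand s′ (suc d + k)           ≡⟨ nth-image s′ 2 (suc d + k) (<-length-drop (suc d) window k k<drop) ⟨
    nth window (suc d + k)          ≡⟨ nth-drop (suc d) window k ⟨
    nth (drop (suc d) window) k     ∎
    where open ≡-Reasoning

-- The blocks of false and true differ in the letter at index 9.
expand-9 : ∀ s a → expand s (a * 17 + 9) ≡ not (s a)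
expand-9 s a = trans (expand-shift s a 9) (trans (at9 (s (a + 0))) (cong (not ∘ s) (+-identityʳ a)))
  where
  at9 : ∀ b → nth (block b) 9 ≡ not b
  at9 false = refl
  at9 true  = refl

-- By synchronization p = 17q, and 17 + p agreements then cover q + 1 whole blocks. The letters at
-- index 9 of these blocks recover an overlap of period q in `s`.
expand-no-repetition : ∀ s → OverlapFree s → ∀ p → 1 ≤ p → ¬ Agree (expand s) 0 p (17 + p)
expand-no-repetition s of p 1≤p ag with period-multiple s p (17 + p) (m≤m+n 17 p) ag
expand-no-repetition s of p () ag | zero , refl
... | suc q , refl = of 0 (suc q) (s≤s z≤n) λ k k< → not-injective (begin
  not (s k)                                ≡⟨ expand-9 s k ⟨
  expand s (k * 17 + 9)                    ≡⟨ ag (k * 17 + 9) (<-≤-trans (+-monoʳ-< (k * 17) (m≤m+n 10 7)) (bound k (s≤s⁻¹ k<))) ⟩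
  expand s (suc q * 17 + (k * 17 + 9))     ≡⟨ cong (expand s) (arith (suc q) k) ⟩
  expand s ((suc q + k) * 17 + 9)          ≡⟨ expand-9 s (suc q + k) ⟩
  not (s (suc q + k))                      ∎)
  where
  open ≡-Reasoning
  arith : ∀ q k → q * 17 + (k * 17 + 9) ≡ (q + k) * 17 + 9
  arith = solve-∀
  bound : ∀ k → k ≤ suc q → k * 17 + 17 ≤ 17 + suc q * 17
  bound k k≤ = ≤-trans (+-monoˡ-≤ 17 (*-monoˡ-≤ 17 k≤)) (≤-reflexive (+-comm (suc q * 17) 17))

-- Cubes in expansions

NoShortCubeAt : Word → Set
NoShortCubeAt w = ∀ r p → r < 17 → p ≤ 17 → ¬ CubeAt w r p

-- Four blocks suffice: a start in the first block and three periods of at most 17 stay within 17 +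
-- 51 = 68 letters.
image-no-short-cube : ∀ a b c d → CubeFree (a ∷ b ∷ c ∷ d ∷ []) → NoShortCubeAt (image (a ∷ b ∷ c ∷ d ∷ []) end)
image-no-short-cube a b c d cf = check a b c d cf
  where
  ok : ∀ x → T (not (cubeWithin false 17 17 (image x end))) → NoShortCubeAt (image x end)
  ok x h r p r<17 p≤17 c = T-not-elim h (cubeAt-within 17 17 (image x end) r p r<17 p≤17 c)

  check : ∀ a b c d → CubeFree (a ∷ b ∷ c ∷ d ∷ []) → NoShortCubeAt (image (a ∷ b ∷ c ∷ d ∷ []) end)
  check false false false false = cubeful (false ∷ false ∷ false ∷ false ∷ []) tt
  check false false false true  = cubeful (false ∷ false ∷ false ∷ true ∷ []) tt
  check false false true  false = λ _ → ok (false ∷ false ∷ true ∷ false ∷ []) tt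
  check false false true  true  = λ _ → ok (false ∷ false ∷ true ∷ true ∷ []) tt
  check false true  false false = λ _ → ok (false ∷ true ∷ false ∷ false ∷ []) tt
  check false true  false true  = λ _ → ok (false ∷ true ∷ false ∷ true ∷ []) tt
  check false true  true  false = λ _ → ok (false ∷ true ∷ true ∷ false ∷ []) tt
  check false true  true  true  = cubeful (false ∷ true ∷ true ∷ true ∷ []) tt
  check true  false false false = cubeful (true ∷ false ∷ false ∷ false ∷ []) tt
  check true  false false true  = λ _ → ok (true ∷ false ∷ false ∷ true ∷ []) tt
  check true  false true  false = λ _ → ok (true ∷ false ∷ true ∷ false ∷ []) tt
  check true  false true  true  = λ _ → ok (true ∷ false ∷ true ∷ true ∷ []) tt
  check true  true  false false = λ _ → ok (true ∷ true ∷ false ∷ false ∷ []) tt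
  check true  true  false true  = λ _ → ok (true ∷ true ∷ false ∷ true ∷ []) tt
  check true  true  true  false = cubeful (true ∷ true ∷ true ∷ false ∷ []) tt
  check true  true  true  true  = cubeful (true ∷ true ∷ true ∷ true ∷ []) tt

-- Periods up to 17 are settled by the finite check. For a longer one the agreement is taken from
-- the next block boundary on, at most 17 letters away. Its first 17 letters force 17 to divide p,
-- hence p ≥ 34, and this leaves the 17 + p agreements that `expand-no-repetition` excludes.
expand-no-cube-near-0 : ∀ s → OverlapFree s → ∀ r p → r < 17 → 1 ≤ p → ¬ Agree (expand s) r (r + p) (p + p)
expand-no-cube-near-0 s of r p r<17 1≤p ag with p ≤? 17
... | yes p≤17 =
  image-no-short-cube (s 0) (s 1) (s 2) (s 3) (overlapFree⇒cubeFree s of 4) r p r<17 p≤17 (1≤p , len , ag′)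
  where
  window : Word
  window = image (applyUpTo s 4) end
  len : r + (p + (p + p)) ≤ length window
  len = ≤-trans (+-mono-≤ (<⇒≤ r<17) (+-mono-≤ p≤17 (+-mono-≤ p≤17 p≤17)))
    (≤-trans (m≤m+n 68 3) (≤-reflexive (sym (length-image (applyUpTo s 4) end))))
  ag′ : Agree (nth window) r (r + p) (p + p)
  ag′ k k< = trans (nth-image s 4 (r + k) (≤-<-trans (+-monoˡ-≤ k (m≤m+n r p)) inside))
    (trans (ag k k<) (sym (nth-image s 4 (r + p + k) inside)))
    where
    inside : r + p + k < length window
    inside = <-≤-trans (+-monoʳ-< (r + p) k<) (≤-trans (≤-reflexive (+-assoc r p (p + p))) len)
... | no p≰17 = expand-no-repetition (s ∘ suc) (overlapFree-shift s 1 of) p 1≤p (fromNextBlock (17 + p) (begin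
    d + (17 + p)  ≤⟨ +-monoˡ-≤ (17 + p) (m∸n≤m 17 r) ⟩
    34 + p        ≤⟨ +-monoˡ-≤ p 34≤p ⟩
    p + p         ∎))
  where
  open ≤-Reasoning
  18≤p : 18 ≤ p
  18≤p = ≰⇒> p≰17
  d : ℕ
  d = 17 ∸ r
  r+d≡17 : r + d ≡ 17
  r+d≡17 = m+[n∸m]≡n (<⇒≤ r<17)
  fromNextBlock : ∀ m → d + m ≤ p + p → Agree (expand (s ∘ suc)) 0 p m
  fromNextBlock m le k k<m = trans (sym (expand-shift s 1 k))
    (trans (cong (λ j → expand s (j + k)) (sym r+d≡17))
      (trans (agree-restrict (expand s) r (r + p) d m le ag k k<m)
        (trans (cong (λ j → expand s (j + k)) (trans (swap r p d) (cong (_+ p) r+d≡17))) (expand-shift s 1 (p + k)))))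
    where
    swap : ∀ r p d → r + p + d ≡ r + d + p
    swap = solve-∀
  34≤p : 34 ≤ p
  34≤p = multiple (period-multiple (s ∘ suc) p 17 ≤-refl
    (fromNextBlock 17 (≤-trans (+-monoˡ-≤ 17 (m∸n≤m 17 r)) (+-mono-≤ (<⇒≤ 18≤p) (<⇒≤ 18≤p)))))
    where
    multiple : (∃ λ q → p ≡ q * 17) → 34 ≤ p
    multiple (zero        , eq) = ⊥-elim (p≰17 (subst (_≤ 17) (sym eq) z≤n))
    multiple (suc zero    , eq) = ⊥-elim (p≰17 (≤-reflexive eq))
    multiple (suc (suc q) , eq) = subst (34 ≤_) (sym eq) (m≤m+n 34 (q * 17))

-- Dropping i / 17 whole blocks moves the start into the first block.
expand-no-cube : ∀ s → OverlapFree s → ∀ i p → 1 ≤ p → ¬ Agree (expand s) i (i + p) (p + p)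
expand-no-cube s of i p 1≤p ag =
  expand-no-cube-near-0 (λ i → s (a + i)) (overlapFree-shift s a of) r p (m%n<n i 17) 1≤p λ k k< →
    trans (sym (expand-shift s a (r + k)))
      (trans (cong (expand s) (trans (arith₁ a r k) (cong (_+ k) (sym i≡))))
        (trans (ag k k<)
          (trans (cong (expand s) (trans (cong (λ i → i + p + k) i≡) (arith₂ a r p k))) (expand-shift s a (r + p + k)))))
  where
  a r : ℕ
  a = i / 17
  r = i % 17
  i≡ : i ≡ r + a * 17
  i≡ = m≡m%n+[m/n]*n i 17
  arith₁ : ∀ a r k → a * 17 + (r + k) ≡ r + a * 17 + k
  arith₁ = solve-∀
  arith₂ : ∀ a r p k → r + a * 17 + p + k ≡ a * 17 + (r + p + k)
  arith₂ = solve-∀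

-- Removing letters from images

-- Indices 17 to 33 are the middle block, so the created cube may use letters of both neighbours.
blocks-irreducible : ∀ a b c → CubeFree (a ∷ b ∷ c ∷ []) → ∀ i → 17 ≤ i → i < 34 →
                     ContainsCube (removeAt i (image (a ∷ b ∷ c ∷ []) []))
blocks-irreducible a b c cf i 17≤i i<34 = check a b c cf i 17≤i i<34
  where
  Claim : Word → Set
  Claim w = ∀ i → 17 ≤ i → i < 34 → ContainsCube (removeAt i w)

  ok : ∀ w → T (removalsCubeful 17 17 w) → Claim w
  ok = removalsCubeful-sound 17 17

  check : ∀ a b c → CubeFree (a ∷ b ∷ c ∷ []) → Claim (image (a ∷ b ∷ c ∷ []) [])
  check false false false = cubeful (false ∷ false ∷ false ∷ []) tt
  check false false true  = λ _ → ok (image (false ∷ false ∷ true ∷ []) []) tt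
  check false true  false = λ _ → ok (image (false ∷ true ∷ false ∷ []) []) tt
  check false true  true  = λ _ → ok (image (false ∷ true ∷ true ∷ []) []) tt
  check true  false false = λ _ → ok (image (true ∷ false ∷ false ∷ []) []) tt
  check true  false true  = λ _ → ok (image (true ∷ false ∷ true ∷ []) []) tt
  check true  true  false = λ _ → ok (image (true ∷ true ∷ false ∷ []) []) tt
  check true  true  true  = cubeful (true ∷ true ∷ true ∷ []) tt

-- Only `end` follows the last whole block. Indices 17 to 35 are that block and `end` without its
-- final letter, which is not interior.
blocks-end-irreducible : ∀ a b i → 17 ≤ i → suc i < length (image (a ∷ b ∷ []) end) →
                         ContainsCube (removeAt i (image (a ∷ b ∷ []) end))
blocks-end-irreducible a b i = check a b i
  where
  Claim : Word → Set
  Claim w = ∀ i → 17 ≤ i → suc i < length w → ContainsCube (removeAt i w)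

  ok : ∀ w → length w ≡ 37 → T (removalsCubeful 17 19 w) → Claim w
  ok w eq h i 17≤i i< = removalsCubeful-sound 17 19 w h i 17≤i (s≤s⁻¹ (subst (suc i <_) eq i<))

  check : ∀ a b → Claim (image (a ∷ b ∷ []) end)
  check false false = ok (image (false ∷ false ∷ []) end) refl tt
  check false true  = ok (image (false ∷ true ∷ []) end) refl tt
  check true  false = ok (image (true ∷ false ∷ []) end) refl tt
  check true  true  = ok (image (true ∷ true ∷ []) end) refl tt

removeAt-window : ∀ w z i → i < length w → ContainsCube (removeAt i w) → ContainsCube (removeAt i (w ++ z))
removeAt-window w z i i<w c =
  subst ContainsCube (sym (removeAt-++ˡ w z i i<w)) (containsCube-++ʳ (removeAt i w) z c)

removeAt-later : ∀ u w i → length u ≤ i → ContainsCube (removeAt (i ∸ length u) w) →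
                 ContainsCube (removeAt i (u ++ w))
removeAt-later u w i u≤i c = subst (λ i → ContainsCube (removeAt i (u ++ w))) (m+[n∸m]≡n u≤i)
  (subst ContainsCube (sym (removeAt-++ʳ u w (i ∸ length u))) (containsCube-++ˡ u _ c))

later-interior : ∀ (u w : Word) i → length u ≤ i → suc i < length (u ++ w) → suc (i ∸ length u) < length w
later-interior u w i u≤i i< = +-cancelˡ-< (length u) _ _
  (subst (_< length u + length w) (sym (trans (+-suc (length u) (i ∸ length u)) (cong suc (m+[n∸m]≡n u≤i))))
    (subst (suc i <_) (length-++ u) i<))

-- Induction on the number of blocks: a letter of the second block is handled by the first three
-- blocks, a later one after the first block is dropped. The first block has no left neighbour and
-- is left to the prefix.
image-irreducible : ∀ s → OverlapFree s → ∀ k i → 17 ≤ i → suc i < length (image (applyUpTo s (2 + k)) end) →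
                    ContainsCube (removeAt i (image (applyUpTo s (2 + k)) end))
image-irreducible s of zero    i 17≤i i< = blocks-end-irreducible (s 0) (s 1) i 17≤i i<
image-irreducible s of (suc k) i 17≤i i< with i <? 34
... | yes i<34 = subst (ContainsCube ∘ removeAt i) (sym split)
  (removeAt-window window rest i (<-≤-trans i<34 (≤-trans (m≤m+n 34 17) (≤-reflexive (sym (length-image x [])))))
    (blocks-irreducible (s 0) (s 1) (s 2) (overlapFree⇒cubeFree s of 3) i 17≤i i<34))
  where
  x window rest : Word
  x      = applyUpTo s 3
  window = image x []
  rest   = image (applyUpTo (λ i → s (3 + i)) k) end
  split : image (applyUpTo s (3 + k)) end ≡ window ++ rest
  -- By computation the left side is `image x rest`.
  split = image-end x rest
... | no i≮34 = removeAt-later B rest i B≤i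
  (image-irreducible (s ∘ suc) (overlapFree-shift s 1 of) k (i ∸ length B) 17≤i∸B (later-interior B rest i B≤i i<))
  where
  B rest : Word
  B    = block (s 0)
  rest = image (applyUpTo (s ∘ suc) (2 + k)) end
  34≤i : 34 ≤ i
  34≤i = ≮⇒≥ i≮34
  B≤i : length B ≤ i
  B≤i = subst (_≤ i) (sym (length-block (s 0))) 17≤i
  17≤i∸B : 17 ≤ i ∸ length B
  17≤i∸B = subst (λ m → 17 ≤ i ∸ m) (sym (length-block (s 0))) (∸-monoˡ-≤ 17 34≤i)

-- Prefixed images of the Thue–Morse sequence

prefixed : Word → ℕ → Word
prefixed P k = P ++ image (applyUpTo thueMorse k) end

-- Serves the removals that `image-irreducible` does not reach, those in the prefix and in the first
-- block.
window₂ : Word → Word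
window₂ P = P ++ image (applyUpTo thueMorse 2) []

-- A cube with period p > 42 that starts in the prefix needs no check: as
-- 26 + (17 + p) ≤ 2p, it shifts 17 + p letters of the expansion by p.
suitablePrefix : Word → Bool
suitablePrefix P =
  ⌊ 1 ≤? length P ⌋ ∧ ⌊ length P ≤? 26 ⌋ ∧ not (cubeWithin false (length P) 42 (prefixed P 8)) ∧
  removalsCubeful 1 (length P + 16) (window₂ P)

record Suitable (P : Word) : Set where
  field
    nonempty    : 1 ≤ length P
    short       : length P ≤ 26
    no-cube     : ∀ i p → i < length P → p ≤ 42 → ¬ CubeAt (prefixed P 8) i p
    irreducible : ∀ i → 1 ≤ i → i < length P + 17 → ContainsCube (removeAt i (window₂ P))

suitablePrefix-sound : ∀ P → T (suitablePrefix P) → Suitable P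
suitablePrefix-sound P h =
  let h₁ , h₁′ = ⇒ (T-∧ {⌊ 1 ≤? length P ⌋}) h
      h₂ , h₂′ = ⇒ (T-∧ {⌊ length P ≤? 26 ⌋}) h₁′
      h₃ , h₄  = ⇒ (T-∧ {not (cubeWithin false (length P) 42 (prefixed P 8))}) h₂′
  in record
  { nonempty    = toWitness h₁
  ; short       = toWitness h₂
  ; no-cube     = λ i p i<P p≤42 c → T-not-elim h₃ (cubeAt-within (length P) 42 (prefixed P 8) i p i<P p≤42 c)
  -- The `length P + 16` removals start at index 1, so they reach the end of the first block.
  ; irreducible = λ i 1≤i i< → removalsCubeful-sound 1 (length P + 16) (window₂ P) h₄ i 1≤i
      (subst (i <_) (+-suc (length P) 16) i<)
  }

prefixed-later : ∀ P k j → length P + j < length (prefixed P k) →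
                 nth (prefixed P k) (length P + j) ≡ expand thueMorse j
prefixed-later P k j j< = trans (nth-++ʳ P _ j)
  (nth-image thueMorse k j (+-cancelˡ-< (length P) _ _ (subst (length P + j <_) (length-++ P) j<)))

-- Both words are prefixes of one infinite word. This carries the check made with eight blocks over
-- to any number of blocks.
prefixed-consistent : ∀ P k l j → j < length (prefixed P k) → j < length (prefixed P l) →
                      nth (prefixed P k) j ≡ nth (prefixed P l) j
prefixed-consistent []      k l j       j<k       j<l       =
  trans (nth-image thueMorse k j j<k) (sym (nth-image thueMorse l j j<l))
prefixed-consistent (x ∷ P) k l zero    _         _         = refl
prefixed-consistent (x ∷ P) k l (suc j) (s≤s j<k) (s≤s j<l) = prefixed-consistent P k l j j<k j<l

length-prefixed : ∀ P k → length (prefixed P k) ≡ length P + (k * 17 + 3)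
length-prefixed P k = trans (length-++ P) (cong (length P +_)
  (trans (length-image (applyUpTo thueMorse k) end) (cong (λ m → m * 17 + 3) (length-applyUpTo thueMorse k))))

module _ {P : Word} (suit : Suitable P) (k : ℕ) where
  open Suitable suit

  private
    w : Word
    w = prefixed P k

  -- A cube that starts behind `P` lies in the expansion. One that starts in `P` is excluded by the
  -- check on eight blocks if its period is at most 42; otherwise its part behind `P` contradicts
  -- `expand-no-repetition`.
  prefixed-no-cube : ∀ i p → ¬ CubeAt w i p
  prefixed-no-cube i p (1≤p , len , ag) with i <? length P | p ≤? 42
  ... | no i≮P | _ = expand-no-cube thueMorse thueMorse-overlapFree (i ∸ length P) p 1≤p λ m m< →
    trans (sym (prefixed-later P k (i ∸ length P + m)
                 (subst (_< length w) (at m) (≤-<-trans (+-monoˡ-≤ m (m≤m+n i p)) (inside m m<)))))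
      (trans (cong (nth w) (sym (at m)))
        (trans (ag m m<)
          (trans (cong (nth w) (at′ m)) (prefixed-later P k _ (subst (_< length w) (at′ m) (inside m m<))))))
    where
    P≤i : length P ≤ i
    P≤i = ≮⇒≥ i≮P
    at : ∀ m → i + m ≡ length P + (i ∸ length P + m)
    at m = trans (cong (_+ m) (sym (m+[n∸m]≡n P≤i))) (+-assoc (length P) _ m)
    at′ : ∀ m → i + p + m ≡ length P + (i ∸ length P + p + m)
    at′ m = trans (+-assoc i p m) (trans (at (p + m)) (cong (length P +_) (sym (+-assoc (i ∸ length P) p m))))
    inside : ∀ m → m < p + p → i + p + m < length w
    inside m m< = <-≤-trans (+-monoʳ-< (i + p) m<) (≤-trans (≤-reflexive (+-assoc i p (p + p))) len)
  ... | yes i<P | yes p≤42 = no-cube i p i<P p≤42 (1≤p , len₈ , λ m m< →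
    trans (prefixed-consistent P 8 k (i + m)
            (within m m< len₈) (within m m< len))
      (trans (ag m m<) (prefixed-consistent P k 8 (i + p + m) (inside m m< len) (inside m m< len₈))))
    where
    -- Three periods of at most 42 take at most 126 letters behind `P`; eight blocks and `end`
    -- supply 139.
    len₈ : i + (p + (p + p)) ≤ length (prefixed P 8)
    len₈ = ≤-trans (+-mono-≤ (<⇒≤ i<P) (+-mono-≤ p≤42 (+-mono-≤ p≤42 p≤42)))
      (≤-trans (+-monoʳ-≤ (length P) (m≤m+n 126 13)) (≤-reflexive (sym (length-prefixed P 8))))
    inside : ∀ m → m < p + p → ∀ {n} → i + (p + (p + p)) ≤ n → i + p + m < n
    inside m m< le = <-≤-trans (+-monoʳ-< (i + p) m<) (≤-trans (≤-reflexive (+-assoc i p (p + p))) le)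
    within : ∀ m → m < p + p → ∀ {n} → i + (p + (p + p)) ≤ n → i + m < n
    within m m< le = ≤-<-trans (+-monoˡ-≤ m (m≤m+n i p)) (inside m m< le)
  ... | yes i<P | no p≰42 = expand-no-repetition thueMorse thueMorse-overlapFree p 1≤p λ m m< →
    trans (sym (prefixed-later P k m (<-≤-trans (+-monoʳ-< (length P) m<) fits₀)))
      (trans (subst (λ j → nth w (j + m) ≡ nth w (length P + (p + m))) i+d≡P
               (trans (agree-restrict (nth w) i (i + p) d (17 + p) d+17+p≤2p ag m m<) (cong (nth w) (at m))))
        (prefixed-later P k (p + m) (<-≤-trans (+-monoʳ-< (length P) (+-monoʳ-< p m<)) fits)))
    where
    open ≤-Reasoning
    d : ℕ
    d = length P ∸ i
    i+d≡P : i + d ≡ length P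
    i+d≡P = m+[n∸m]≡n (<⇒≤ i<P)
    d+17+p≤2p : d + (17 + p) ≤ p + p
    d+17+p≤2p = begin
      d + (17 + p)  ≤⟨ +-monoˡ-≤ (17 + p) (≤-trans (m∸n≤m (length P) i) short) ⟩
      43 + p        ≤⟨ +-monoˡ-≤ p (≰⇒> p≰42) ⟩
      p + p         ∎
    swap : ∀ i p d m → i + p + d + m ≡ i + d + (p + m)
    swap = solve-∀
    at : ∀ m → i + p + d + m ≡ length P + (p + m)
    at m = trans (swap i p d m) (cong (_+ (p + m)) i+d≡P)
    regroup : ∀ i d p n → i + d + (p + n) ≡ i + (p + (d + n))
    regroup = solve-∀
    -- The compared letters all lie in the cube, hence inside `w`, where its letters are those of
    -- the expansion.
    fits : length P + (p + (17 + p)) ≤ length w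
    fits = begin
      length P + (p + (17 + p))   ≡⟨ cong (_+ (p + (17 + p))) i+d≡P ⟨
      i + d + (p + (17 + p))      ≡⟨ regroup i d p (17 + p) ⟩
      i + (p + (d + (17 + p)))    ≤⟨ +-monoʳ-≤ i (+-monoʳ-≤ p d+17+p≤2p) ⟩
      i + (p + (p + p))           ≤⟨ len ⟩
      length w                    ∎
    fits₀ : length P + (17 + p) ≤ length w
    fits₀ = ≤-trans (+-monoʳ-≤ (length P) (m≤n+m (17 + p) p)) fits

-- Two blocks at least are present, so `window₂ P` is a prefix and settles removals up to the end of
-- the first block. Later ones fall to `image-irreducible` once `P` is dropped.
prefixed-irreducible : ∀ {P} → Suitable P → ∀ k → IrreducibleCubeFree (prefixed P (2 + k))
prefixed-irreducible {P} suit k =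
  (λ c → let i , p , at = containsCube⇒cubeAt _ c in prefixed-no-cube suit (2 + k) i p at) ,
  subst (3 ≤_) (sym (length-prefixed P (2 + k))) (≤-trans (m≤n+m 3 ((2 + k) * 17)) (m≤n+m ((2 + k) * 17 + 3) (length P))) ,
  removal
  where
  open Suitable suit
  rest : Word
  rest = image (applyUpTo (λ i → thueMorse (2 + i)) k) end
  split : prefixed P (2 + k) ≡ window₂ P ++ rest
  split = trans (cong (P ++_) (image-end (applyUpTo thueMorse 2) rest)) (sym (++-assoc P _ rest))
  removal : ∀ i → 1 ≤ i → suc i < length (prefixed P (2 + k)) → ContainsCube (removeAt i (prefixed P (2 + k)))
  removal i 1≤i i< with i <? length P + 17
  ... | yes i<P+17 = subst (ContainsCube ∘ removeAt i) (sym split)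
    (removeAt-window (window₂ P) rest i
      (<-≤-trans i<P+17 (≤-trans (+-monoʳ-≤ (length P) (m≤m+n 17 17)) (≤-reflexive (sym (length-++ P)))))
      (irreducible i 1≤i i<P+17))
  ... | no i≮P+17 = removeAt-later P _ i P≤i
    (image-irreducible thueMorse thueMorse-overlapFree k (i ∸ length P)
      (m+n≤o⇒m≤o∸n 17 (subst (_≤ i) (+-comm (length P) 17) (≮⇒≥ i≮P+17))) (later-interior P _ i P≤i i<))
    where
    P≤i : length P ≤ i
    P≤i = ≤-trans (m≤m+n _ 17) (≮⇒≥ i≮P+17)

-- The lengths

-- The prefixes, one for each length mod 17, and the words below were found by
-- a backtracking search.
prefixes : Vec String 17
prefixes =
    "1011010011" ∷ᵛ
    "01001011010" ∷ᵛ
    "011010110011" ∷ᵛ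
    "1011010110011" ∷ᵛ
    "01001011010011" ∷ᵛ
    "010010110110010" ∷ᵛ
    "1001010011001010" ∷ᵛ
    "01001010011001010" ∷ᵛ
    "101101001011010011" ∷ᵛ
    "1011010010110110010" ∷ᵛ
    "01001011010010110010" ∷ᵛ
    "101101001010011001010" ∷ᵛ
    "1001010011001010011010" ∷ᵛ
    "01001011010010110110010" ∷ᵛ
    "101101001011010010110010" ∷ᵛ
    "1011010110011010110110010" ∷ᵛ
    "01101011001101101001011010" ∷ᵛ []ᵛ

prefixes-suitable : ∀ j → T (suitablePrefix (word (lookup prefixes j)))
prefixes-suitable = toWitness {a? = all? (λ j → T? (suitablePrefix (word (lookup prefixes j))))} tt

prefixes-length : ∀ j → length (word (lookup prefixes j)) ≡ 10 + toℕ j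
prefixes-length = toWitness {a? = all? (λ j → length (word (lookup prefixes j)) ≟ 10 + toℕ j)} tt

mediumWords : Vec String 25
mediumWords =
    "0100101101001011010010" ∷ᵛ
    "01001011001010011010010" ∷ᵛ
    "010010100110010100101101" ∷ᵛ
    "0100101100101001100101001" ∷ᵛ
    "01001010011001010011010010" ∷ᵛ
    "010010110010010110100101101" ∷ᵛ
    "0100101001100101001011010010" ∷ᵛ
    "01001011010011010110011010110" ∷ᵛ
    "010010100110010100110100101101" ∷ᵛ
    "0100101100100101101001011010010" ∷ᵛ
    "01001010011001010010011011010010" ∷ᵛ
    "010010100110010100101001100101001" ∷ᵛ
    "0100101001100100101101001011010010" ∷ᵛ
    "01001010011001010011010110011010110" ∷ᵛ
    "010010100110010100100110110100101101" ∷ᵛ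
    "0100101001100101001011001010011010010" ∷ᵛ
    "01001010011001001011010010110100100110" ∷ᵛ
    "010010100110010010110100101101001001101" ∷ᵛ
    "0100101001100101001001101101001011010010" ∷ᵛ
    "01001010011001010010011010010110100101101" ∷ᵛ
    "010010100110010100100110110101100110101101" ∷ᵛ
    "0100101001100100101101001011010010011010010" ∷ᵛ
    "01001010011001010010011011010010011011010010" ∷ᵛ
    "010010100110010010110100101101001001100101001" ∷ᵛ
    "0100101001100100101101001011010010011001010010" ∷ᵛ []ᵛ

mediumWords-irreducible : ∀ j → T (isIrreducible (word (lookup mediumWords j)))
mediumWords-irreducible = toWitness {a? = all? (λ j → T? (isIrreducible (word (lookup mediumWords j))))} tt

mediumWords-length : ∀ j → length (word (lookup mediumWords j)) ≡ 22 + toℕ j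
mediumWords-length = toWitness {a? = all? (λ j → length (word (lookup mediumWords j)) ≟ 22 + toℕ j)} tt

Realized : ℕ → Set
Realized n = ∃ λ w → IrreducibleCubeFree w × length w ≡ n

medium-realized : ∀ j → j < 25 → Realized (22 + j)
medium-realized j j<25 =
  word (lookup mediumWords i) ,
  isIrreducible-sound (word (lookup mediumWords i)) (mediumWords-irreducible i) ,
  trans (mediumWords-length i) (cong (22 +_) (toℕ-fromℕ< j<25))
  where
  i : Fin 25
  i = fromℕ< j<25

-- The shortest prefix, two blocks and `end` have 10 + 34 + 3 = 47 letters. The residue of m selects
-- the prefix, the quotient the number of further blocks.
long-realized : ∀ m → Realized (47 + m)
long-realized m =
  prefixed P (2 + m / 17) ,
  prefixed-irreducible (suitablePrefix-sound P (prefixes-suitable j)) (m / 17) ,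
  (begin
    length (prefixed P (2 + m / 17))          ≡⟨ length-prefixed P (2 + m / 17) ⟩
    length P + ((2 + m / 17) * 17 + 3)        ≡⟨ cong (_+ ((2 + m / 17) * 17 + 3)) (trans (prefixes-length j) (cong (10 +_) (toℕ-fromℕ< r<17))) ⟩
    10 + m % 17 + ((2 + m / 17) * 17 + 3)     ≡⟨ arith (m % 17) (m / 17) ⟩
    47 + (m % 17 + m / 17 * 17)               ≡⟨ cong (47 +_) (m≡m%n+[m/n]*n m 17) ⟨
    47 + m                                    ∎)
  where
  open ≡-Reasoning
  r<17 : m % 17 < 17
  r<17 = m%n<n m 17
  j : Fin 17
  j = fromℕ< r<17
  P : Word
  P = word (lookup prefixes j)
  arith : ∀ r q → 10 + r + ((2 + q) * 17 + 3) ≡ 47 + (r + q * 17)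
  arith = solve-∀

from-22-realized : ∀ m → Realized (22 + m)
from-22-realized m with m <? 25
... | yes m<25 = medium-realized m m<25
-- 22 + 25 = 47 is the first length reached by prefixed images.
... | no  m≮25 = subst (Realized ∘ (22 +_)) (m+[n∸m]≡n (≮⇒≥ m≮25)) (long-realized (m ∸ 25))

realized : ∀ s → T (isIrreducible (word s)) → Realized (length (word s))
realized s h = word s , isIrreducible-sound (word s) h , refl

admissible-realized : ∀ n → Admissible n → Realized n
admissible-realized _ (inj₁ refl) = realized "0100101101" tt
admissible-realized _ (inj₂ (inj₁ refl)) = realized "01001011010010" tt
admissible-realized _ (inj₂ (inj₂ (inj₁ refl))) = realized "010010110100101101" tt
admissible-realized _ (inj₂ (inj₂ (inj₂ (inj₁ refl)))) = realized "0100101001100101001" tt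
admissible-realized _ (inj₂ (inj₂ (inj₂ (inj₂ (inj₁ refl))))) = realized "01001010011001010010" tt
admissible-realized n (inj₂ (inj₂ (inj₂ (inj₂ (inj₂ 22≤n)))))       =
  subst Realized (m+[n∸m]≡n 22≤n) (from-22-realized (n ∸ 22))

-- Every length above 21 is admissible, so only the search on short words has content here.
realized-admissible : ∀ n → Realized n → Admissible n
realized-admissible _ (w , irr , refl) with length w ≤? 21
... | yes w≤21 = short-admissible w w≤21 irr
... | no  w≰21 = inj₂ (inj₂ (inj₂ (inj₂ (inj₂ (≰⇒> w≰21)))))

theorem2 : (n : ℕ) →
    (∃ λ w → IrreducibleCubeFree w × length w ≡ n)
    ⇔ (n ≡ 10 ⊎ n ≡ 14 ⊎ n ≡ 18 ⊎ n ≡ 19 ⊎ n ≡ 20 ⊎ 22 ≤ n)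
theorem2 n = mk⇔ (realized-admissible n) (admissible-realized n)
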